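{- For all integers $n\geq 3$, the recurrence relation \[(n+1)\,\mathrm{BoNa}_n(u)=(2n-1)(1+u)\,\mathrm{BoNa}_{n-1}(u)-(n-2)(u^2-6u+1)\,\mathrm{BoNa}_{n-2}(u)\] holds, where $\mathrm{BoNa}_m(u)=\sum_{k=1}^m \mathrm{BoNa}(m,k)u^k$ for every positive integer $m$.
   Context: A binary plane tree is a rooted plane tree on unlabeled vertices in which every non-leaf vertex has one or two children, and every child is a left child or a right child, even if it is the only child of its parent. A 0-1-tree is a binary plane tree in which every vertex that has two children is labeled 0 or 1 (no other vertex is labeled). A right edge is an edge connecting a vertex to its right child. For $n\ge 1$, the Boolean-Narayana number $\mathrm{BoNa}(n,k)$ is the number of 0-1-trees on $n$ vertices that have exactly $k-1$ right edges. -}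

module Defs where

open import Data.Fin.Base using (Fin)
open import Data.Integer.Base as ℤ using (ℤ; +_; 0ℤ; 1ℤ)
open import Data.List.Base
  using (List; []; _∷_; _++_; map; foldr; filter; length; applyUpTo; allFin
        ; cartesianProduct; cartesianProductWith)
open import Data.List.Membership.Propositional using (_∈_)
open import Data.List.Membership.Propositional.Properties
  using (∈-map⁺; ∈-map⁻; ∈-++⁺ˡ; ∈-++⁺ʳ; ∈-++⁻; ∈-allFin; ∈-cartesianProduct⁺
        ; ∈-cartesianProductWith⁺; ∈-cartesianProductWith⁻; ∈-filter⁺; ∈-filter⁻)
open import Data.List.Relation.Binary.Disjoint.Propositional using (Disjoint)
open import Data.List.Relation.Unary.All as All using ()
open import Data.List.Relation.Unary.AllPairs using ([]; _∷_)
open import Data.List.Relation.Unary.Any using (here; there)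
open import Data.List.Relation.Unary.Unique.Propositional using (Unique)
open import Data.List.Relation.Unary.Unique.Propositional.Properties as Unique using ()
open import Data.Nat.Base using (ℕ; zero; suc; _+_; _≤_; z≤n; s≤s)
open import Data.Nat.Properties
  using (_≟_; ≤-reflexive; ≤-trans; m≤m+n; m≤n+m)
open import Data.Product.Base using (_×_; _,_; proj₂)
open import Data.Sum.Base using (inj₁; inj₂)
open import Function.Bundles using (_⇔_; mk⇔)
open import Relation.Binary.PropositionalEquality.Core using (_≡_; _≢_; refl)
open import Relation.Nullary.Decidable using (Dec; _×-dec_)

data ZeroOneTree : Set where
  leaf      : ZeroOneTree
  onlyLeft  : ZeroOneTree → ZeroOneTree
  onlyRight : ZeroOneTree → ZeroOneTree
  both      : (label : Fin 2) (l r : ZeroOneTree) → ZeroOneTree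

vertices : ZeroOneTree → ℕ
vertices leaf          = 1
vertices (onlyLeft l)  = 1 + vertices l
vertices (onlyRight r) = 1 + vertices r
vertices (both _ l r)  = 1 + (vertices l + vertices r)

rightEdges : ZeroOneTree → ℕ
rightEdges leaf          = 0
rightEdges (onlyLeft l)  = rightEdges l
rightEdges (onlyRight r) = 1 + rightEdges r
rightEdges (both _ l r)  = 1 + (rightEdges l + rightEdges r)

-- All trees with at most h levels.  Any tree with n vertices has at most n
-- levels, so treesUpToHeight n contains every tree with n vertices.
treesUpToHeight : ℕ → List ZeroOneTree
treesUpToHeight zero    = []
treesUpToHeight (suc h) =
  leaf ∷ map onlyLeft ts ++ map onlyRight ts
       ++ cartesianProductWith (λ (b , l) r → both b l r) (cartesianProduct (allFin 2) ts) ts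
  where ts = treesUpToHeight h

-- "k - 1 right edges" is written additively, avoiding truncated subtraction.
Counted : ℕ → ℕ → ZeroOneTree → Set
Counted n k t = vertices t ≡ n × rightEdges t + 1 ≡ k

counted? : ∀ n k t → Dec (Counted n k t)
counted? n k t = (vertices t ≟ n) ×-dec (rightEdges t + 1 ≟ k)

countedTrees : ℕ → ℕ → List ZeroOneTree
countedTrees n k = filter (counted? n k) (treesUpToHeight n)

-- By ∈-countedTrees and countedTrees-unique below, this length is the
-- cardinality of the set of trees satisfying Counted n k.
BoNa : ℕ → ℕ → ℕ
BoNa n k = length (countedTrees n k)

∈-treesUpToHeight : ∀ h t → vertices t ≤ h → t ∈ treesUpToHeight h
∈-treesUpToHeight (suc h) leaf          _       = here refl
∈-treesUpToHeight (suc h) (onlyLeft l)  (s≤s p) =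
  there (∈-++⁺ˡ (∈-map⁺ onlyLeft (∈-treesUpToHeight h l p)))
∈-treesUpToHeight (suc h) (onlyRight r) (s≤s p) =
  there (∈-++⁺ʳ (map onlyLeft (treesUpToHeight h))
    (∈-++⁺ˡ (∈-map⁺ onlyRight (∈-treesUpToHeight h r p))))
∈-treesUpToHeight (suc h) (both b l r)  (s≤s p) =
  there (∈-++⁺ʳ (map onlyLeft ts) (∈-++⁺ʳ (map onlyRight ts)
    (∈-cartesianProductWith⁺ (λ (b , l) r → both b l r)
      (∈-cartesianProduct⁺ (∈-allFin b)
        (∈-treesUpToHeight h l (≤-trans (m≤m+n (vertices l) (vertices r)) p)))
      (∈-treesUpToHeight h r (≤-trans (m≤n+m (vertices r) (vertices l)) p)))))
  where ts = treesUpToHeight h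

∈-countedTrees : ∀ n k t → t ∈ countedTrees n k ⇔ Counted n k t
∈-countedTrees n k t = mk⇔
  (λ t∈ → proj₂ (∈-filter⁻ (counted? n k) {xs = treesUpToHeight n} t∈))
  (λ c@(v≡n , _) →
    ∈-filter⁺ (counted? n k) (∈-treesUpToHeight n t (≤-reflexive v≡n)) c)

treesUpToHeight-unique : ∀ h → Unique (treesUpToHeight h)
treesUpToHeight-unique zero    = []
treesUpToHeight-unique (suc h) =
  All.tabulate leaf≢
  ∷ Unique.++⁺ (Unique.map⁺ (λ { refl → refl }) ih)
      (Unique.++⁺ (Unique.map⁺ (λ { refl → refl }) ih)
        (Unique.cartesianProductWith⁺ _ (λ { refl → refl , refl })
          (Unique.cartesianProduct⁺ (Unique.allFin⁺ 2) ih) ih)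
        right#both)
      left#rest
  where
  ts  = treesUpToHeight h
  ih  = treesUpToHeight-unique h
  bls = cartesianProduct (allFin 2) ts
  mk : Fin 2 × ZeroOneTree → ZeroOneTree → ZeroOneTree
  mk (b , l) r = both b l r
  bs  = cartesianProductWith mk bls ts

  right#both : Disjoint (map onlyRight ts) bs
  right#both (x∈ , y∈) with ∈-map⁻ onlyRight x∈ | ∈-cartesianProductWith⁻ mk bls ts y∈
  ... | _ , _ , refl | _ , _ , _ , _ , ()

  left#rest : Disjoint (map onlyLeft ts) (map onlyRight ts ++ bs)
  left#rest (x∈ , y∈) with ∈-map⁻ onlyLeft x∈ | ∈-++⁻ (map onlyRight ts) y∈
  ... | _ , _ , refl | inj₁ r∈ with () ← proj₂ (proj₂ (∈-map⁻ onlyRight r∈))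
  ... | _ , _ , refl | inj₂ b∈ with ∈-cartesianProductWith⁻ mk bls ts b∈
  ...   | _ , _ , _ , _ , ()

  leaf≢ : ∀ {t} → t ∈ map onlyLeft ts ++ map onlyRight ts ++ bs → leaf ≢ t
  leaf≢ t∈ refl with ∈-++⁻ (map onlyLeft ts) t∈
  ... | inj₁ l∈ with () ← proj₂ (proj₂ (∈-map⁻ onlyLeft l∈))
  ... | inj₂ x∈ with ∈-++⁻ (map onlyRight ts) x∈
  ...   | inj₁ r∈ with () ← proj₂ (proj₂ (∈-map⁻ onlyRight r∈))
  ...   | inj₂ b∈ with ∈-cartesianProductWith⁻ mk bls ts b∈
  ...     | _ , _ , _ , _ , ()

countedTrees-unique : ∀ n k → Unique (countedTrees n k)
countedTrees-unique n k = Unique.filter⁺ (counted? n k) (treesUpToHeight-unique n)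

-- ℤ[u]: a polynomial is its list of coefficients, constant term first.
-- Trailing zeros are allowed, so equality is _≈_ rather than _≡_.
Poly : Set
Poly = List ℤ

coeff : Poly → ℕ → ℤ
coeff []      _       = 0ℤ
coeff (a ∷ p) zero    = a
coeff (a ∷ p) (suc i) = coeff p i

infix  4 _≈_
infixl 6 _⊕_ _⊖_
infixl 7 _⊗_
infixr 7 _·_
infixr 8 _^_

_≈_ : Poly → Poly → Set
p ≈ q = ∀ i → coeff p i ≡ coeff q i

_⊕_ : Poly → Poly → Poly
[]      ⊕ q       = q
(a ∷ p) ⊕ []      = a ∷ p
(a ∷ p) ⊕ (b ∷ q) = (a ℤ.+ b) ∷ (p ⊕ q)

_·_ : ℤ → Poly → Poly
c · p = map (c ℤ.*_) p

_⊖_ : Poly → Poly → Poly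
p ⊖ q = p ⊕ (ℤ.- 1ℤ) · q

_⊗_ : Poly → Poly → Poly
[]      ⊗ q = []
(a ∷ p) ⊗ q = a · q ⊕ (0ℤ ∷ p ⊗ q)

𝟙 : Poly
𝟙 = 1ℤ ∷ []

u : Poly
u = 0ℤ ∷ 1ℤ ∷ []

_^_ : Poly → ℕ → Poly
p ^ zero  = 𝟙
p ^ suc k = p ⊗ (p ^ k)

-- Σ_{k=1}^{m} f k
sum₁ : ℕ → (ℕ → Poly) → Poly
sum₁ m f = foldr _⊕_ [] (applyUpTo (λ i → f (suc i)) m)

BoNaPoly : ℕ → Poly
BoNaPoly m = sum₁ m (λ k → (+ BoNa m k) · u ^ k)

{-# OPTIONS --safe #-}
module Submission where

-- Splitting a tree at its root shows that g = Σ BoNa(n,k) uᵏ zⁿ satisfies g = z (u + c g + 2 g²)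
-- with c = 1 + u.  So S = 1 - c z - 4 z g is a square root of the discriminant
-- 1 - 2 c z + d z², d = u² - 6 u + 1, and applying θ = z d/dz to the quadratic gives S θg = g.
-- Multiplying by S yields the linear equation (1 - 2 c z + d z²) θg = 2 z u - (1 - c z) g,
-- whose coefficient of zⁿ is the recurrence.

open import Algebra.Bundles using (AbelianGroup; CommutativeSemiring)
import Algebra.Construct.Pointwise as Pointwise
import Algebra.Definitions
import Algebra.Properties.CommutativeMonoid.Mult
open import Algebra.Properties.Group using (∙-cancelʳ)
import Algebra.Properties.Semiring.Mult
import Algebra.Solver.Ring.NaturalCoefficients.Default as NaturalCoefficients
open import Algebra.Structures.Biased using (isCommutativeSemiringˡ)
open import Data.Integer.Base using (ℤ; 0ℤ; 1ℤ)
import Data.Integer as ℤ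
import Data.Integer.Properties as ℤ
import Data.Integer.Solver as ℤ
open import Data.List.Base
  using (List; []; _∷_; _++_; _∷ʳ_; map; foldr; filter; length; applyUpTo; allFin
        ; cartesianProduct; cartesianProductWith)
import Data.List.Properties as List
import Data.List.Relation.Unary.All as All
open import Data.Nat.Base using (ℕ; zero; suc; z≤n; s≤s)
import Data.Nat as ℕ
import Data.Nat.Properties as ℕ
import Data.Nat.Solver as ℕ
open import Data.Product.Base using (_,_)
open import Function.Base using (_∘_)
import Relation.Binary.PropositionalEquality as ≡
import Relation.Binary.Reasoning.Setoid as SetoidReasoning
open import Relation.Nullary.Decidable using (yes; no)
open import Relation.Nullary.Negation using (¬_; contradiction)

-- Weighted sums and elimination over a commutative semiring.

module CommutativeSemiringLemmas {a ℓ} (R : CommutativeSemiring a ℓ) where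
  open CommutativeSemiring R
  open Algebra.Definitions _≈_ using (RightCancellative)
  open SetoidReasoning setoid
  open NaturalCoefficients R using (solve; con; _:=_; _:+_; _:*_)

  double : Carrier → Carrier
  double x = x + x

  sumOf : ∀ {b} {B : Set b} → (B → Carrier) → List B → Carrier
  sumOf w []       = 0#
  sumOf w (x ∷ xs) = w x + sumOf w xs

  module _ {b} {B : Set b} where
    sumOf-cong : {v w : B → Carrier} → (∀ x → v x ≈ w x) → ∀ xs → sumOf v xs ≈ sumOf w xs
    sumOf-cong v≈w []       = refl
    sumOf-cong v≈w (x ∷ xs) = +-cong (v≈w x) (sumOf-cong v≈w xs)

    sumOf-++ : ∀ (w : B → Carrier) xs ys → sumOf w (xs ++ ys) ≈ sumOf w xs + sumOf w ys
    sumOf-++ w []       ys = sym (+-identityˡ _)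
    sumOf-++ w (x ∷ xs) ys = trans (+-congˡ (sumOf-++ w xs ys)) (sym (+-assoc _ _ _))

    sumOf-*ˡ : ∀ x (w : B → Carrier) ys → sumOf (λ y → x * w y) ys ≈ x * sumOf w ys
    sumOf-*ˡ x w []       = sym (zeroʳ x)
    sumOf-*ˡ x w (y ∷ ys) = trans (+-congˡ (sumOf-*ˡ x w ys)) (sym (distribˡ _ _ _))

    sumOf-map : ∀ {c} {C : Set c} (w : C → Carrier) (f : B → C) xs →
      sumOf w (map f xs) ≈ sumOf (w ∘ f) xs
    sumOf-map w f []       = refl
    sumOf-map w f (x ∷ xs) = +-congˡ (sumOf-map w f xs)

  sumOf-cartesianProductWith :
    ∀ {b c d} {B : Set b} {C : Set c} {D : Set d}
    (f : B → C → D) {u : D → Carrier} (v : B → Carrier) (w : C → Carrier) →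
    (∀ x y → u (f x y) ≈ v x * w y) →
    ∀ xs ys → sumOf u (cartesianProductWith f xs ys) ≈ sumOf v xs * sumOf w ys
  sumOf-cartesianProductWith f         v w uf≈vw []       ys = sym (zeroˡ _)
  sumOf-cartesianProductWith f {u = u} v w uf≈vw (x ∷ xs) ys = begin
    sumOf u (map (f x) ys ++ cartesianProductWith f xs ys)
      ≈⟨ sumOf-++ u (map (f x) ys) _ ⟩
    sumOf u (map (f x) ys) + sumOf u (cartesianProductWith f xs ys)
      ≈⟨ +-cong (trans (sumOf-map u (f x) ys)
                  (trans (sumOf-cong (uf≈vw x) ys) (sumOf-*ˡ (v x) w ys)))
                (sumOf-cartesianProductWith f v w uf≈vw xs ys) ⟩
    v x * sumOf w ys + sumOf v xs * sumOf w ys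
      ≈⟨ distribʳ _ _ _ ⟨
    (v x + sumOf v xs) * sumOf w ys ∎

  -- The factor z + (z + 0#) is the sum of z over the two labels.
  leaf+left+right+both : ∀ z u g →
    z * u + (z * g + (z * (u * g) + ((z + (z + 0#)) * g) * g))
    ≈ z * (u + ((1# + u) * g + double (g * g)))
  leaf+left+right+both = solve 3 (λ z u g →
    z :* u :+ (z :* g :+ (z :* (u :* g) :+ ((z :+ (z :+ con 0)) :* g) :* g))
    := z :* (u :+ ((con 1 :+ u) :* g :+ (g :* g :+ g :* g)))) refl

  -- To stay within semirings, subtraction is avoided by adding to both sides the multiples of
  -- the hypotheses (and of 8 u z² h) that the computation over a ring would cancel.
  quadratic⇒linear-ode : RightCancellative _+_ → ∀ z u c d g h →
    g ≈ z * (u + (c * g + double (g * g))) →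
    h ≈ g + z * (c * h + double (h * g + g * h)) →
    d + double (double (double u)) ≈ c * c →
    (g + h) + z * (z * (d * h)) ≈ z * (c * (g + double h)) + double (z * u)
  quadratic⇒linear-ode cancelʳ z u c d g h g≈ h≈ d+8u≈c² = cancelʳ extra _ _ (begin
    (g + h) + z * (z * (d * h)) + extra
      ≈⟨ solve 6 (λ z d u₈ g h x →
           (g :+ h) :+ z :* (z :* (d :* h)) :+ (u₈ :* (z :* (z :* h)) :+ x)
           := (g :+ h) :+ (d :+ u₈) :* (z :* (z :* h)) :+ x)
           refl z d (double (double (double u))) g h (h′ + (p * h + q * g′)) ⟩
    (g + h) + (d + double (double (double u))) * z²h + (h′ + (p * h + q * g′))
      ≈⟨ +-congʳ (+-congˡ (*-congʳ d+8u≈c²)) ⟩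
    (g + h) + (c * c) * z²h + (h′ + (p * h + q * g′))
      ≈⟨ solve 5 (λ z u c g h →
           let g′ = z :* (u :+ (c :* g :+ (g :* g :+ g :* g)))
               h′ = g :+ z :* (c :* h :+ ((h :* g :+ g :* h) :+ (h :* g :+ g :* h)))
               p  = z :* c :+ con 4 :* (z :* g)
               q  = con 8 :* (z :* h) :+ con 2
               2u = u :+ u
               4u = 2u :+ 2u
               8u = 4u :+ 4u
               z²h = z :* (z :* h)
           in (g :+ h) :+ (c :* c) :* z²h :+ (h′ :+ (p :* h :+ q :* g′))
              := z :* (c :* (g :+ (h :+ h))) :+ (z :* u :+ z :* u)
                 :+ (8u :* z²h :+ (h :+ (p :* h′ :+ q :* g))))
           refl z u c g h ⟩
    rhs + (double (double (double u)) * z²h + (h + (p * h′ + q * g)))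
      -- The preceding identity is purely formal; the equations for `g` and `h` enter only here,
      -- exchanging primed and unprimed terms.
      ≈⟨ +-congˡ (+-congˡ (+-cong h≈ (+-cong (*-congˡ (sym h≈)) (*-congˡ g≈)))) ⟩
    rhs + extra ∎)
    where
    g′ = z * (u + (c * g + double (g * g)))
    h′ = g + z * (c * h + double (h * g + g * h))
    4# = ((1# + 1#) + 1#) + 1#
    -- Over a ring, the left side minus the right side is (1 - p)(h - h′) + q (g - g′). Here 1 - p
    -- is S. In q, the summand 8 z h comes from using the quadratic in S² h, and the summand 2 from
    -- using it in S g. The numerals are nested as the solver interprets `con 4`, `con 8` and
    -- `con 2`.
    p  = z * c + 4# * (z * g)
    q  = ((((4# + 1#) + 1#) + 1#) + 1#) * (z * h) + (1# + 1#)
    z²h = z * (z * h)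
    extra = double (double (double u)) * z²h + (h′ + (p * h + q * g′))
    rhs = z * (c * (g + double h)) + double (z * u)

-- Formal power series over a commutative semiring.

module PowerSeries {a ℓ} (R : CommutativeSemiring a ℓ) where
  private module R = CommutativeSemiring R
  open R using
    (Carrier; _≈_; _+_; _*_; 0#; 1#; refl; sym; trans; +-cong; +-congˡ; +-congʳ; *-cong)
  open SetoidReasoning R.setoid
  open Algebra.Properties.Semiring.Mult R.semiring using (_×_; ×-congʳ; ×-comm-*)
  open Algebra.Properties.CommutativeMonoid.Mult R.+-commutativeMonoid using (×-distrib-+)
  open NaturalCoefficients R using (solve; _:=_; _:+_; _:*_)

  Series : Set a
  Series = ℕ → Carrier

  shift : Series → Series
  shift f zero    = 0#
  shift f (suc n) = f n

  monomial : ℕ → Carrier → Series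
  monomial zero    x zero    = x
  monomial zero    x (suc n) = 0#
  monomial (suc i) x         = shift (monomial i x)

  const : Carrier → Series
  const = monomial 0

  -- Writing f as f 0 plus z times `f ∘ suc` replaces the sum over index pairs by a recursion, so
  -- the semiring laws become inductions on the index with f generalised.
  convolution : Series → Series → Series
  convolution f g zero    = f 0 * g 0
  convolution f g (suc n) = f 0 * g (suc n) + convolution (f ∘ suc) g n

  -- Agreement is asked only up to index n. This locality is what later shows that each iterate of
  -- the quadratic map determines one more coefficient.
  convolution-cong : ∀ {f f′ g g′} n →
    (∀ m → m ℕ.≤ n → f m ≈ f′ m) → (∀ m → m ℕ.≤ n → g m ≈ g′ m) →
    convolution f g n ≈ convolution f′ g′ n
  convolution-cong zero    f≈ g≈ = *-cong (f≈ 0 z≤n) (g≈ 0 z≤n)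
  convolution-cong (suc n) f≈ g≈ = +-cong
    (*-cong (f≈ 0 z≤n) (g≈ (suc n) ℕ.≤-refl))
    (convolution-cong n (λ m m≤n → f≈ (suc m) (s≤s m≤n)) (λ m m≤n → g≈ m (ℕ.m≤n⇒m≤1+n m≤n)))

  convolution-zeroˡ : ∀ g n → convolution (λ _ → 0#) g n ≈ 0#
  convolution-zeroˡ g zero    = R.zeroˡ _
  convolution-zeroˡ g (suc n) =
    trans (+-cong (R.zeroˡ _) (convolution-zeroˡ g n)) (R.+-identityˡ 0#)

  convolution-constˡ : ∀ x g n → convolution (const x) g n ≈ x * g n
  convolution-constˡ x g zero    = refl
  convolution-constˡ x g (suc n) = trans (+-congˡ (convolution-zeroˡ g n)) (R.+-identityʳ _)

  convolution-distribʳ : ∀ g f f′ n →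
    convolution (λ m → f m + f′ m) g n ≈ convolution f g n + convolution f′ g n
  convolution-distribʳ g f f′ zero    = R.distribʳ _ _ _
  convolution-distribʳ g f f′ (suc n) = begin
    (f 0 + f′ 0) * g (suc n) + convolution (λ m → f (suc m) + f′ (suc m)) g n
      ≈⟨ +-congˡ (convolution-distribʳ g (f ∘ suc) (f′ ∘ suc) n) ⟩
    (f 0 + f′ 0) * g (suc n) + (convolution (f ∘ suc) g n + convolution (f′ ∘ suc) g n)
      ≈⟨ solve 5 (λ x x′ y v v′ → (x :+ x′) :* y :+ (v :+ v′) := (x :* y :+ v) :+ (x′ :* y :+ v′))
           refl _ _ _ _ _ ⟩
    convolution f g (suc n) + convolution f′ g (suc n) ∎

  convolution-*ˡ : ∀ x f g n → convolution (λ m → x * f m) g n ≈ x * convolution f g n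
  convolution-*ˡ x f g zero    = R.*-assoc _ _ _
  convolution-*ˡ x f g (suc n) = begin
    x * f 0 * g (suc n) + convolution (λ m → x * f (suc m)) g n
      ≈⟨ +-cong (R.*-assoc _ _ _) (convolution-*ˡ x (f ∘ suc) g n) ⟩
    x * (f 0 * g (suc n)) + x * convolution (f ∘ suc) g n
      ≈⟨ R.distribˡ _ _ _ ⟨
    x * convolution f g (suc n) ∎

  -- The mirror image of the defining clause, splitting off the constant term of the right factor;
  -- commutativity then follows by induction.
  convolution-sucʳ : ∀ f g n →
    convolution f g (suc n) ≈ convolution f (g ∘ suc) n + f (suc n) * g 0
  convolution-sucʳ f g zero    = refl
  convolution-sucʳ f g (suc n) =
    trans (+-congˡ (convolution-sucʳ (f ∘ suc) g n)) (sym (R.+-assoc _ _ _))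

  convolution-comm : ∀ f g n → convolution f g n ≈ convolution g f n
  convolution-comm f g zero    = R.*-comm _ _
  convolution-comm f g (suc n) = begin
    convolution f g (suc n)
      ≈⟨ convolution-sucʳ f g n ⟩
    convolution f (g ∘ suc) n + f (suc n) * g 0
      ≈⟨ +-cong (convolution-comm f (g ∘ suc) n) (R.*-comm _ _) ⟩
    convolution (g ∘ suc) f n + g 0 * f (suc n)
      ≈⟨ R.+-comm _ _ ⟩
    convolution g f (suc n) ∎

  convolution-assoc : ∀ f g h n →
    convolution (convolution f g) h n ≈ convolution f (convolution g h) n
  convolution-assoc f g h zero    = R.*-assoc _ _ _
  convolution-assoc f g h (suc n) = begin
    f 0 * g 0 * h (suc n) + convolution (λ m → f 0 * g (suc m) + convolution (f ∘ suc) g m) h n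
      ≈⟨ +-congˡ (convolution-distribʳ h _ (convolution (f ∘ suc) g) n) ⟩
    f 0 * g 0 * h (suc n)
      + (convolution (λ m → f 0 * g (suc m)) h n + convolution (convolution (f ∘ suc) g) h n)
      ≈⟨ +-congˡ (+-cong (convolution-*ˡ (f 0) (g ∘ suc) h n) (convolution-assoc (f ∘ suc) g h n)) ⟩
    f 0 * g 0 * h (suc n)
      + (f 0 * convolution (g ∘ suc) h n + convolution (f ∘ suc) (convolution g h) n)
      ≈⟨ solve 5 (λ x y z v w → x :* y :* z :+ (x :* v :+ w) := x :* (y :* z :+ v) :+ w)
           refl _ _ _ _ _ ⟩
    convolution f (convolution g h) (suc n) ∎

  commutativeSemiring : CommutativeSemiring a ℓ
  commutativeSemiring = record
    { Carrier = Series
    ; _≈_     = λ f g → ∀ n → f n ≈ g n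
    ; _+_     = λ f g n → f n + g n
    ; _*_     = convolution
    ; 0#      = λ _ → 0#
    ; 1#      = const 1#
    ; isCommutativeSemiring = isCommutativeSemiringˡ record
      { +-isCommutativeMonoid = Pointwise.isCommutativeMonoid ℕ R.+-isCommutativeMonoid
      ; *-isCommutativeMonoid = record
        { isMonoid = record
          { isSemigroup = record
            { isMagma = record
              { isEquivalence = Pointwise.isEquivalence ℕ R.isEquivalence
              ; ∙-cong = λ f≈ g≈ n → convolution-cong n (λ m _ → f≈ m) (λ m _ → g≈ m)
              }
            ; assoc = convolution-assoc
            }
          ; identity = const-identityˡ
                     , λ f n → trans (convolution-comm f (const 1#) n) (const-identityˡ f n)
          }
        ; comm = convolution-comm
        }
      ; distribʳ = convolution-distribʳ
      ; zeroˡ    = convolution-zeroˡ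
      }
    }
    where
    const-identityˡ : ∀ f n → convolution (const 1#) f n ≈ f n
    const-identityˡ f n = trans (convolution-constˡ 1# f n) (R.*-identityˡ (f n))

  private
    module S = CommutativeSemiring commutativeSemiring

  +-cancelʳ : Algebra.Definitions.RightCancellative _≈_ _+_ →
    Algebra.Definitions.RightCancellative S._≈_ S._+_
  +-cancelʳ cancelʳ f g h eq n = cancelʳ (f n) (g n) (h n) (eq n)

  const-cong : ∀ {x y} → x ≈ y → const x S.≈ const y
  const-cong x≈y zero    = x≈y
  const-cong x≈y (suc n) = refl

  const-+ : ∀ x y → const (x + y) S.≈ const x S.+ const y
  const-+ x y zero    = refl
  const-+ x y (suc n) = sym (R.+-identityˡ 0#)

  const-* : ∀ x y → const (x * y) S.≈ const x S.* const y
  const-* x y zero    = refl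
  const-* x y (suc n) =
    sym (trans (convolution-constˡ x (const y) (suc n)) (R.zeroʳ x))

  z : Series
  z = monomial 1 1#

  convolution-shiftˡ : ∀ f g → shift f S.* g S.≈ shift (f S.* g)
  convolution-shiftˡ f g zero    = R.zeroˡ _
  convolution-shiftˡ f g (suc n) = trans (+-congʳ (R.zeroˡ _)) (R.+-identityˡ _)

  shift-cong : ∀ {f g} → f S.≈ g → shift f S.≈ shift g
  shift-cong f≈g zero    = refl
  shift-cong f≈g (suc n) = f≈g n

  z*-shift : ∀ f → z S.* f S.≈ shift f
  z*-shift f = S.trans (convolution-shiftˡ _ f) (shift-cong (S.*-identityˡ f))

  monomial-cong : ∀ i {x y} → x ≈ y → monomial i x S.≈ monomial i y
  monomial-cong zero    x≈y = const-cong x≈y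
  monomial-cong (suc i) x≈y = shift-cong (monomial-cong i x≈y)

  monomial-* : ∀ i j x y → monomial i x S.* monomial j y S.≈ monomial (i ℕ.+ j) (x * y)
  monomial-* zero    zero    x y = S.sym (const-* x y)
  monomial-* zero    (suc j) x y = S.trans (convolution-comm _ _)
    (S.trans (convolution-shiftˡ _ _)
      (shift-cong (S.trans (convolution-comm _ _) (monomial-* zero j x y))))
  monomial-* (suc i) j       x y =
    S.trans (convolution-shiftˡ _ _) (shift-cong (monomial-* i j x y))

  monomial-diag : ∀ i x → monomial i x i ≈ x
  monomial-diag zero    x = refl
  monomial-diag (suc i) x = monomial-diag i x

  monomial-off-diag : ∀ i x n → ¬ i ≡.≡ n → monomial i x n ≈ 0#
  monomial-off-diag zero    x zero    i≢n = contradiction ≡.refl i≢n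
  monomial-off-diag zero    x (suc n) i≢n = refl
  monomial-off-diag (suc i) x zero    i≢n = refl
  monomial-off-diag (suc i) x (suc n) i≢n = monomial-off-diag i x n (i≢n ∘ ≡.cong suc)

  -- θ is the Euler derivation z d/dz.
  θ : Series → Series
  θ f n = n × f n

  θ-cong : ∀ {f g} → f S.≈ g → θ f S.≈ θ g
  θ-cong f≈g n = ×-congʳ n (f≈g n)

  θ-+ : ∀ f g → θ (f S.+ g) S.≈ θ f S.+ θ g
  θ-+ f g n = ×-distrib-+ (f n) (g n) n

  θ-const : ∀ x → θ (const x) S.≈ S.0#
  θ-const x zero    = refl
  θ-const x (suc n) = ×-zeroʳ (suc n)
    where
    ×-zeroʳ : ∀ n → n × 0# ≈ 0#
    ×-zeroʳ zero    = refl
    ×-zeroʳ (suc n) = trans (R.+-identityˡ _) (×-zeroʳ n)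

  θ-z : θ z S.≈ z
  θ-z zero          = refl
  θ-z (suc zero)    = R.+-identityʳ 1#
  θ-z (suc (suc n)) = trans (R.+-identityˡ _) (θ-const 1# (suc n))

  -- The Leibniz rule, by induction along `convolution`. Passing to the tail lowers every index by
  -- one, so `suc n ×` leaves one spare copy of `v n`, to be absorbed into the derivative of f.
  θ-* : ∀ f g → θ (f S.* g) S.≈ θ f S.* g S.+ f S.* θ g
  θ-* f g zero    = sym (trans (+-cong (R.zeroˡ _) (R.zeroʳ _)) (R.+-identityˡ 0#))
  θ-* f g (suc n) = begin
    suc n × (f 0 * g (suc n) + v n)
      ≈⟨ ×-distrib-+ _ _ (suc n) ⟩
    suc n × (f 0 * g (suc n)) + (v n + θ v n)
      ≈⟨ +-cong (sym (×-comm-* (suc n) _ _)) (+-congˡ (θ-* (f ∘ suc) g n)) ⟩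
    f 0 * θ g (suc n) + (v n + (convolution (θ (f ∘ suc)) g n + convolution (f ∘ suc) (θ g) n))
      ≈⟨ solve 4 (λ x y s t → x :+ (y :+ (s :+ t)) := (y :+ s) :+ (x :+ t)) refl _ _ _ _ ⟩
    (v n + convolution (θ (f ∘ suc)) g n) + (f 0 * θ g (suc n) + convolution (f ∘ suc) (θ g) n)
      -- At each index `θ f ∘ suc` unfolds to `f ∘ suc` plus `θ (f ∘ suc)`, which absorbs the spare
      -- `v n`.
      ≈⟨ +-congʳ (convolution-distribʳ g (f ∘ suc) (θ (f ∘ suc)) n) ⟨
    convolution (θ f ∘ suc) g n + convolution f (θ g) (suc n)
      -- `θ f 0` is `0#`, so restoring the leading term of the convolution changes nothing.
      ≈⟨ +-congʳ (trans (+-congʳ (R.zeroˡ _)) (R.+-identityˡ _)) ⟨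
    convolution (θ f) g (suc n) + convolution f (θ g) (suc n) ∎
    where v = convolution (f ∘ suc) g

  -- From the quadratic equation to the coefficient recurrence.

  private
    module L = CommutativeSemiringLemmas R
    module M = CommutativeSemiringLemmas commutativeSemiring

  -- This is S θg = g without subtraction. In the Leibniz rule for z x, θ z = z makes the first
  -- summand z x, which is g again by the quadratic; inside x, θ kills the constants u and c.
  quadratic⇒θ-equation : ∀ u c g →
    g S.≈ z S.* (const u S.+ (const c S.* g S.+ M.double (g S.* g))) →
    θ g S.≈ g S.+ z S.* (const c S.* θ g S.+ M.double (θ g S.* g S.+ g S.* θ g))
  quadratic⇒θ-equation u c g g≈ = S.trans (θ-cong g≈) (S.trans (θ-* z x)
    (S.+-cong (S.trans (S.*-congʳ θ-z) (S.sym g≈)) (S.*-congˡ {z} θx≈)))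
    where
    x = const u S.+ (const c S.* g S.+ M.double (g S.* g))
    θ-constˡ : ∀ y f → θ (const y S.* f) S.≈ const y S.* θ f
    θ-constˡ y f = S.trans (θ-* (const y) f)
      (S.trans (S.+-congʳ (S.trans (S.*-congʳ (θ-const y)) (S.zeroˡ f))) (S.+-identityˡ _))
    θx≈ : θ x S.≈ const c S.* θ g S.+ M.double (θ g S.* g S.+ g S.* θ g)
    θx≈ = S.trans (θ-+ (const u) _) (S.trans (S.+-congʳ (θ-const u)) (S.trans (S.+-identityˡ _)
      (S.trans (θ-+ (const c S.* g) _)
        (S.+-cong (θ-constˡ c g) (S.trans (θ-+ _ _) (S.+-cong (θ-* g g) (θ-* g g)))))))

  quadratic⇒recurrence : Algebra.Definitions.RightCancellative _≈_ _+_ → ∀ u c d g →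
    g S.≈ z S.* (const u S.+ (const c S.* g S.+ M.double (g S.* g))) →
    d + L.double (L.double (L.double u)) ≈ c * c →
    ∀ n → (g (2 ℕ.+ n) + (2 ℕ.+ n) × g (2 ℕ.+ n)) + d * (n × g n)
          ≈ c * (g (1 ℕ.+ n) + L.double ((1 ℕ.+ n) × g (1 ℕ.+ n)))
  quadratic⇒recurrence cancelʳ u c d g g≈ d+8u≈c² n = begin
    (g (2 ℕ.+ n) + (2 ℕ.+ n) × g (2 ℕ.+ n)) + d * (n × g n)
      ≈⟨ +-congˡ (trans (z*-shift _ (2 ℕ.+ n))
           (trans (z*-shift _ (1 ℕ.+ n)) (convolution-constˡ d (θ g) n))) ⟨
    ((g S.+ θ g) S.+ z S.* (z S.* (const d S.* θ g))) (2 ℕ.+ n)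
      ≈⟨ M.quadratic⇒linear-ode (+-cancelʳ cancelʳ) z (const u) (const c) (const d) g (θ g)
           g≈ (quadratic⇒θ-equation u c g g≈) const-d+8u≈c² (2 ℕ.+ n) ⟩
    (z S.* (const c S.* (g S.+ M.double (θ g))) S.+ M.double (z S.* const u)) (2 ℕ.+ n)
      -- The inhomogeneous term 2 z u lives in degree 1, so it vanishes in degree 2 + n; this is why
      -- the recurrence is stated from index 2 on.
      ≈⟨ +-cong (trans (z*-shift _ (2 ℕ.+ n)) (convolution-constˡ c _ (1 ℕ.+ n)))
           (trans (+-cong (z*-shift (const u) (2 ℕ.+ n)) (z*-shift (const u) (2 ℕ.+ n)))
             (R.+-identityˡ 0#)) ⟩
    c * (g (1 ℕ.+ n) + L.double (θ g (1 ℕ.+ n))) + 0#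
      ≈⟨ R.+-identityʳ _ ⟩
    c * (g (1 ℕ.+ n) + L.double ((1 ℕ.+ n) × g (1 ℕ.+ n))) ∎
    where
    const-double : ∀ {x f} → f S.≈ const x → M.double f S.≈ const (L.double x)
    const-double f≈ = S.trans (S.+-cong f≈ f≈) (S.sym (const-+ _ _))
    const-d+8u≈c² : const d S.+ M.double (M.double (M.double (const u))) S.≈ const c S.* const c
    const-d+8u≈c² = S.trans
      (S.+-congˡ (const-double (const-double (const-double S.refl))))
      (S.trans (S.sym (const-+ _ _)) (S.trans (const-cong d+8u≈c²) (const-* c c)))

  -- Solving the quadratic by iteration.

  module QuadraticIteration (u c : Carrier) (g : ℕ → Series) where
    Φ : Series → Series
    Φ f = z S.* (const u S.+ (const c S.* f S.+ M.double (f S.* f)))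

    Φ-zero : ∀ f → Φ f 0 ≈ 0#
    Φ-zero f = R.zeroˡ _

    -- The outer factor z makes `Φ` contracting: coefficient n + 1 of the output depends only on
    -- coefficients up to n of the input.
    Φ-suc-cong : ∀ {f f′} n → (∀ m → m ℕ.≤ n → f m ≈ f′ m) → Φ f (suc n) ≈ Φ f′ (suc n)
    Φ-suc-cong {f} {f′} n f≈ = begin
      Φ f (suc n)
        ≈⟨ z*-shift _ (suc n) ⟩
      const u n + (convolution (const c) f n + L.double (convolution f f n))
        ≈⟨ +-congˡ (+-cong (convolution-cong n (λ _ _ → refl) f≈)
             (+-cong (convolution-cong n f≈ f≈) (convolution-cong n f≈ f≈))) ⟩
      const u n + (convolution (const c) f′ n + L.double (convolution f′ f′ n))
        ≈⟨ z*-shift _ (suc n) ⟨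
      Φ f′ (suc n) ∎

    module _ (g-zero : g 0 S.≈ S.0#) (g-suc : ∀ h → g (suc h) S.≈ Φ (g h)) where
      constant-term : ∀ h → g h 0 ≈ 0#
      constant-term zero    = g-zero 0
      constant-term (suc h) = trans (g-suc h 0) (Φ-zero (g h))

      -- Each iteration settles one more coefficient, starting from the constant term, which is
      -- always zero. For trees this reflects that raising the height bound beyond m adds no tree
      -- with m vertices.
      stable : ∀ {n h h′} → n ℕ.≤ h → n ℕ.≤ h′ → ∀ m → m ℕ.≤ n → g h m ≈ g h′ m
      stable _ _ zero _ = trans (constant-term _) (sym (constant-term _))
      stable (s≤s n≤h) (s≤s n≤h′) (suc m) (s≤s m≤n) =
        trans (g-suc _ (suc m)) (trans
          (Φ-suc-cong m (λ k k≤m → stable n≤h n≤h′ k (ℕ.≤-trans k≤m m≤n)))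
          (sym (g-suc _ (suc m))))

      -- Coefficient n + 1 of `Φ` reads `g n` only at indices m up to n, where by stability it
      -- already equals the diagonal entry `g m m`.
      diagonal-fixpoint : (λ n → g n n) S.≈ Φ (λ n → g n n)
      diagonal-fixpoint zero    = trans (g-zero 0) (sym (Φ-zero (λ n → g n n)))
      diagonal-fixpoint (suc n) = trans (g-suc n (suc n))
        (Φ-suc-cong n (λ m m≤n → stable m≤n ℕ.≤-refl m ℕ.≤-refl))

open ≡ using (_≡_; refl; sym; trans; cong; cong₂; module ≡-Reasoning)
open import Defs
open import Data.Nat.Base using (ℕ; _+_; _*_; _∸_; _≤_)
open import Data.Integer.Base using (+_)

-- Bivariate series and the weights of trees.

module ℤ⟦u⟧ where
  open PowerSeries ℤ.+-*-commutativeSemiring public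
  open CommutativeSemiring commutativeSemiring public hiding (zero)
  open CommutativeSemiringLemmas commutativeSemiring public
  open Algebra.Properties.Semiring.Mult semiring public using (_×_; ×-comm-*)

-- The construction is iterated, with series rather than polynomials in u as coefficients: `coeff`
-- embeds `Poly`, and pointwise equality of its images is exactly `_≈_`.
module ℤ⟦u⟧⟦z⟧ where
  open PowerSeries ℤ⟦u⟧.commutativeSemiring public
  open CommutativeSemiring commutativeSemiring public hiding (zero)
  open CommutativeSemiringLemmas commutativeSemiring public

private
  module U = ℤ⟦u⟧
  module Z = ℤ⟦u⟧⟦z⟧

-- Every tree carries one factor u beyond its right edges, matching the index k of `BoNa`. For a
-- leaf it is the inhomogeneous u of the quadratic.
weight : ZeroOneTree → Z.Series
weight t = Z.monomial (vertices t) (U.monomial (rightEdges t + 1) 1ℤ)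

weight-counted : ∀ {n k} t → Counted n k t → weight t n k ≡ 1ℤ
weight-counted t (refl , refl) =
  trans (Z.monomial-diag (vertices t) _ (rightEdges t + 1)) (U.monomial-diag (rightEdges t + 1) 1ℤ)

weight-uncounted : ∀ {n k} t → ¬ Counted n k t → weight t n k ≡ 0ℤ
weight-uncounted {n} {k} t ¬c with vertices t ℕ.≟ n
... | no  v≢n  = Z.monomial-off-diag (vertices t) _ n v≢n k
... | yes refl = trans (Z.monomial-diag (vertices t) _ k)
  (U.monomial-off-diag (rightEdges t + 1) 1ℤ k (λ r≡k → ¬c (refl , r≡k)))

sumOf-weight : ∀ n k ts → Z.sumOf weight ts n k ≡ + length (filter (counted? n k) ts)
sumOf-weight n k []       = refl
sumOf-weight n k (t ∷ ts) with counted? n k t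
... | yes c = trans (cong₂ ℤ._+_ (weight-counted t c) (sumOf-weight n k ts))
  (cong (+_ ∘ length) (sym (List.filter-accept (counted? n k) {t} {ts} c)))
... | no ¬c = trans (cong₂ ℤ._+_ (weight-uncounted t ¬c) (sumOf-weight n k ts))
  (trans (ℤ.+-identityˡ _) (cong (+_ ∘ length) (sym (List.filter-reject (counted? n k) {t} {ts} ¬c))))

coeff-u : coeff u U.≈ U.z
coeff-u 0             = refl
coeff-u 1             = refl
coeff-u (suc (suc _)) = refl

coeff-𝟙⊕u : coeff (𝟙 ⊕ u) U.≈ U.1# U.+ coeff u
coeff-𝟙⊕u 0             = refl
coeff-𝟙⊕u 1             = refl
coeff-𝟙⊕u (suc (suc _)) = refl

weight-leaf : weight leaf Z.≈ Z.z Z.* Z.const (coeff u)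
weight-leaf = Z.trans (Z.shift-cong (Z.const-cong (U.sym coeff-u))) (Z.sym (Z.z*-shift _))

weight-onlyLeft : ∀ l → weight (onlyLeft l) Z.≈ Z.z Z.* weight l
weight-onlyLeft l = Z.sym (Z.z*-shift (weight l))

weight-onlyRight : ∀ r → weight (onlyRight r) Z.≈ Z.z Z.* (Z.const (coeff u) Z.* weight r)
weight-onlyRight r = Z.sym (Z.trans (Z.z*-shift _) (Z.shift-cong
  (Z.trans (Z.monomial-* 0 (vertices r) (coeff u) _)
    (Z.monomial-cong (vertices r) (U.trans (U.*-congʳ coeff-u) (U.z*-shift _))))))

-- No explicit u appears: each subtree brings a spare factor u, of which one pays for the new right
-- edge and the other remains as the spare factor of the whole tree.
weight-both : ∀ b l r → weight (both b l r) Z.≈ (Z.z Z.* weight l) Z.* weight r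
weight-both b l r = Z.sym (Z.trans (Z.*-congʳ {weight r} (Z.z*-shift (weight l)))
  (Z.trans (Z.monomial-* (suc (vertices l)) (vertices r) _ _)
    (Z.monomial-cong (suc (vertices l + vertices r))
      (U.trans (U.monomial-* (rightEdges l + 1) (rightEdges r + 1) 1ℤ 1ℤ)
        (U.reflexive (cong (λ i → U.monomial i 1ℤ) right-edges))))))
  where
  right-edges : rightEdges l + 1 + (rightEdges r + 1) ≡ 1 + (rightEdges l + rightEdges r) + 1
  right-edges = solve 2 (λ x y → x :+ con 1 :+ (y :+ con 1) := con 1 :+ (x :+ y) :+ con 1)
    refl (rightEdges l) (rightEdges r)
    where open ℕ.+-*-Solver

genFun : ℕ → Z.Series
genFun h = Z.sumOf weight (treesUpToHeight h)

open Z.QuadraticIteration (coeff u) (coeff (𝟙 ⊕ u)) genFun using (Φ; diagonal-fixpoint)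

-- Raising the height bound by one is one application of `Φ`, because the four pieces of the list
-- `treesUpToHeight (suc h)` are the four root shapes over trees of height at most h.
genFun-suc : ∀ h → genFun (suc h) Z.≈ Φ (genFun h)
genFun-suc h = Z.trans
  (Z.+-cong weight-leaf (Z.trans (Z.sumOf-++ weight (map onlyLeft ts) _)
    (Z.+-cong lefts (Z.trans (Z.sumOf-++ weight (map onlyRight ts) _) (Z.+-cong rights boths)))))
  (Z.trans (Z.leaf+left+right+both Z.z (Z.const (coeff u)) g)
    (Z.*-congˡ {Z.z} (Z.+-congˡ {Z.const (coeff u)} (Z.+-congʳ (Z.*-congʳ {g} (Z.sym const-1+u))))))
  where
  ts = treesUpToHeight h
  g  = genFun h
  const-1+u : Z.const (coeff (𝟙 ⊕ u)) Z.≈ Z.1# Z.+ Z.const (coeff u)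
  const-1+u = Z.trans (Z.const-cong coeff-𝟙⊕u) (Z.const-+ U.1# (coeff u))
  lefts : Z.sumOf weight (map onlyLeft ts) Z.≈ Z.z Z.* g
  lefts = Z.trans (Z.sumOf-map weight onlyLeft ts)
    (Z.trans (Z.sumOf-cong weight-onlyLeft ts) (Z.sumOf-*ˡ Z.z weight ts))
  rights : Z.sumOf weight (map onlyRight ts) Z.≈ Z.z Z.* (Z.const (coeff u) Z.* g)
  rights = Z.trans (Z.sumOf-map weight onlyRight ts)
    (Z.trans (Z.sumOf-cong weight-onlyRight ts)
      (Z.trans (Z.sumOf-*ˡ Z.z (λ t → Z.const (coeff u) Z.* weight t) ts)
        (Z.*-congˡ {Z.z} (Z.sumOf-*ˡ (Z.const (coeff u)) weight ts))))
  boths : Z.sumOf weight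
            (cartesianProductWith (λ (b , l) r → both b l r) (cartesianProduct (allFin 2) ts) ts)
          Z.≈ ((Z.z Z.+ (Z.z Z.+ Z.0#)) Z.* g) Z.* g
  boths = Z.trans
    -- The root's factor z is charged to the label, so the inner product contributes the sum of z
    -- over `allFin 2`.
    (Z.sumOf-cartesianProductWith _ (λ (b , l) → Z.z Z.* weight l) weight
      (λ (b , l) r → weight-both b l r) (cartesianProduct (allFin 2) ts) ts)
    (Z.*-congʳ {g} (Z.sumOf-cartesianProductWith _,_ (λ _ → Z.z) weight (λ _ _ → Z.refl)
      (allFin 2) ts))

-- Polynomials as coefficient sequences.

coeff-⊕ : ∀ p q → coeff (p ⊕ q) U.≈ coeff p U.+ coeff q
coeff-⊕ []      q       i       = sym (ℤ.+-identityˡ _)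
coeff-⊕ (a ∷ p) []      i       = sym (ℤ.+-identityʳ _)
coeff-⊕ (a ∷ p) (b ∷ q) zero    = refl
coeff-⊕ (a ∷ p) (b ∷ q) (suc i) = coeff-⊕ p q i

coeff-· : ∀ c p i → coeff (c · p) i ≡ c ℤ.* coeff p i
coeff-· c []      i       = sym (ℤ.*-zeroʳ c)
coeff-· c (a ∷ p) zero    = refl
coeff-· c (a ∷ p) (suc i) = coeff-· c p i

coeff-⊗ : ∀ p q → coeff (p ⊗ q) U.≈ coeff p U.* coeff q
coeff-⊗ []      q i       = sym (U.zeroˡ (coeff q) i)
coeff-⊗ (a ∷ p) q zero    = trans (coeff-⊕ (a · q) _ 0)
  (trans (ℤ.+-identityʳ _) (coeff-· a q 0))
coeff-⊗ (a ∷ p) q (suc i) = trans (coeff-⊕ (a · q) _ (suc i))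
  (cong₂ ℤ._+_ (coeff-· a q (suc i)) (coeff-⊗ p q i))

coeff-u^ : ∀ k → coeff (u ^ k) U.≈ U.monomial k 1ℤ
coeff-u^ zero    zero    = refl
coeff-u^ zero    (suc i) = refl
coeff-u^ (suc k) = U.trans (coeff-⊗ u (u ^ k))
  (U.trans (U.*-cong coeff-u (coeff-u^ k)) (U.z*-shift _))

-- `sum₁` unfolds from its lowest term; splitting off the highest one allows induction on the upper
-- bound with the summand fixed.
sum₁-suc : ∀ m f → sum₁ (suc m) f ≈ sum₁ m f ⊕ f (suc m)
sum₁-suc m f i = trans (cong (λ ps → coeff (foldr _⊕_ [] ps) i) (sym (List.applyUpTo-∷ʳ (f ∘ suc) m)))
  (foldr-⊕-∷ʳ (applyUpTo (f ∘ suc) m) (f (suc m)) i)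
  where
  foldr-⊕-∷ʳ : ∀ ps q → foldr _⊕_ [] (ps ∷ʳ q) ≈ foldr _⊕_ [] ps ⊕ q
  foldr-⊕-∷ʳ []       q i = trans (coeff-⊕ q [] i) (ℤ.+-identityʳ _)
  foldr-⊕-∷ʳ (p ∷ ps) q i = begin
    coeff (p ⊕ foldr _⊕_ [] (ps ∷ʳ q)) i
      ≡⟨ coeff-⊕ p _ i ⟩
    coeff p i ℤ.+ coeff (foldr _⊕_ [] (ps ∷ʳ q)) i
      ≡⟨ cong (ℤ._+_ (coeff p i)) (trans (foldr-⊕-∷ʳ ps q i) (coeff-⊕ (foldr _⊕_ [] ps) q i)) ⟩
    coeff p i ℤ.+ (coeff (foldr _⊕_ [] ps) i ℤ.+ coeff q i)
      ≡⟨ ℤ.+-assoc (coeff p i) _ _ ⟨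
    coeff p i ℤ.+ coeff (foldr _⊕_ [] ps) i ℤ.+ coeff q i
      ≡⟨ cong (ℤ._+ coeff q i) (coeff-⊕ p _ i) ⟨
    coeff (p ⊕ foldr _⊕_ [] ps) i ℤ.+ coeff q i
      ≡⟨ coeff-⊕ (p ⊕ foldr _⊕_ [] ps) q i ⟨
    coeff (p ⊕ foldr _⊕_ [] ps ⊕ q) i ∎
    where open ≡-Reasoning

-- Coefficients of the Boolean-Narayana polynomials.

module _ (a : ℕ → ℤ) where
  partialSum : ℕ → Poly
  partialSum m = sum₁ m (λ k → a k · u ^ k)

  coeff-a·u^ : ∀ k i → coeff (a k · u ^ k) i ≡ a k ℤ.* U.monomial k 1ℤ i
  coeff-a·u^ k i = trans (coeff-· (a k) (u ^ k) i) (cong (ℤ._*_ (a k)) (coeff-u^ k i))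

  coeff-a·u^-diag : ∀ k → coeff (a k · u ^ k) k ≡ a k
  coeff-a·u^-diag k = trans (coeff-a·u^ k k)
    (trans (cong (ℤ._*_ (a k)) (U.monomial-diag k 1ℤ)) (ℤ.*-identityʳ (a k)))

  coeff-a·u^-off-diag : ∀ k i → ¬ k ≡ i → coeff (a k · u ^ k) i ≡ 0ℤ
  coeff-a·u^-off-diag k i k≢i = trans (coeff-a·u^ k i)
    (trans (cong (ℤ._*_ (a k)) (U.monomial-off-diag k 1ℤ i k≢i)) (ℤ.*-zeroʳ (a k)))

  partialSum-suc : ∀ m i → coeff (partialSum (suc m)) i
                           ≡ coeff (partialSum m) i ℤ.+ coeff (a (suc m) · u ^ suc m) i
  partialSum-suc m i = trans (sum₁-suc m (λ k → a k · u ^ k) i) (coeff-⊕ (partialSum m) _ i)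

  partialSum-above : ∀ {m i} → m ℕ.< i → coeff (partialSum m) i ≡ 0ℤ
  partialSum-above {zero}      m<i = refl
  partialSum-above {suc m} {i} m<i = trans (partialSum-suc m i)
    (cong₂ ℤ._+_ (partialSum-above (ℕ.<⇒≤ m<i)) (coeff-a·u^-off-diag (suc m) i (ℕ.<⇒≢ m<i)))

  -- The sum starts at k = 1, so its coefficient at 0 is zero, and agreement there is the assumption
  -- on `a 0`.
  partialSum-within : a 0 ≡ 0ℤ → ∀ {m i} → i ≤ m → coeff (partialSum m) i ≡ a i
  partialSum-within a₀≡0 {zero}  z≤n = sym a₀≡0
  partialSum-within a₀≡0 {suc m} {i} i≤1+m with i ℕ.≟ suc m
  ... | yes refl  = trans (partialSum-suc m i)
    (trans (cong₂ ℤ._+_ (partialSum-above (ℕ.≤-refl {suc m})) (coeff-a·u^-diag (suc m))) (ℤ.+-identityˡ _))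
  ... | no  i≢1+m = trans (partialSum-suc m i)
    (trans (cong₂ ℤ._+_ (partialSum-within a₀≡0 (ℕ.≤-pred (ℕ.≤∧≢⇒< i≤1+m i≢1+m)))
                        (coeff-a·u^-off-diag (suc m) i (i≢1+m ∘ sym)))
           (ℤ.+-identityʳ _))

rightEdges<vertices : ∀ t → rightEdges t ℕ.< vertices t
rightEdges<vertices leaf          = s≤s z≤n
rightEdges<vertices (onlyLeft l)  = ℕ.m≤n⇒m≤1+n (rightEdges<vertices l)
rightEdges<vertices (onlyRight r) = s≤s (rightEdges<vertices r)
rightEdges<vertices (both _ l r)  =
  s≤s (ℕ.+-mono-≤ (rightEdges<vertices l) (ℕ.<⇒≤ (rightEdges<vertices r)))

BoNa≡0 : ∀ n k → (∀ t → ¬ Counted n k t) → BoNa n k ≡ 0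
BoNa≡0 n k ¬c = cong length (List.filter-none (counted? n k) (All.universal ¬c (treesUpToHeight n)))

-- Restricting the sum to k from 1 to n loses nothing: k is one more than a number of right edges,
-- so it is not 0, and it is at most n by `rightEdges<vertices`.
coeff-BoNaPoly : ∀ n k → coeff (BoNaPoly n) k ≡ + BoNa n k
coeff-BoNaPoly n k with k ℕ.≤? n
... | yes k≤n = partialSum-within (λ j → + BoNa n j) (cong +_ (BoNa≡0 n 0 no-edges)) k≤n
  where
  no-edges : ∀ t → ¬ Counted n 0 t
  no-edges t (_ , r+1≡0) = contradiction (trans (ℕ.+-comm 1 (rightEdges t)) r+1≡0) λ ()
... | no  k≰n = trans (partialSum-above (λ j → + BoNa n j) (ℕ.≰⇒> k≰n)) (cong +_ (sym (BoNa≡0 n k too-many)))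
  where
  too-many : ∀ t → ¬ Counted n k t
  too-many t (refl , refl) =
    k≰n (ℕ.≤-trans (ℕ.≤-reflexive (ℕ.+-comm (rightEdges t) 1)) (rightEdges<vertices t))

-- `countedTrees n k` filters `treesUpToHeight n`, so the height bound moves with n and the series
-- to study is the diagonal of `genFun`.
genFun-diag : ∀ n → genFun n n U.≈ coeff (BoNaPoly n)
genFun-diag n k =
  trans (sumOf-weight n k (treesUpToHeight n)) (sym (coeff-BoNaPoly n k))

-- This is u² - 6 u + 1 + 8 u = (1 + u)². The coefficient lists are explicit, so each comparison is
-- a computation, and past their ends both sides are zero.
discriminant : coeff (u ^ 2 ⊖ (+ 6) · u ⊕ 𝟙) U.+ U.double (U.double (U.double (coeff u)))
               U.≈ coeff (𝟙 ⊕ u) U.* coeff (𝟙 ⊕ u)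
discriminant i = trans (lhs≡rhs i) (coeff-⊗ (𝟙 ⊕ u) (𝟙 ⊕ u) i)
  where
  lhs≡rhs : coeff (u ^ 2 ⊖ (+ 6) · u ⊕ 𝟙) U.+ U.double (U.double (U.double (coeff u)))
            U.≈ coeff ((𝟙 ⊕ u) ⊗ (𝟙 ⊕ u))
  lhs≡rhs 0 = refl
  lhs≡rhs 1 = refl
  lhs≡rhs 2 = refl
  lhs≡rhs 3 = refl
  lhs≡rhs 4 = refl
  lhs≡rhs (suc (suc (suc (suc (suc _))))) = refl

-- The recurrence over the integers.

×-* : ∀ n f k → (n U.× f) k ≡ + n ℤ.* f k
×-* zero    f k = refl
×-* (suc n) f k = trans (cong (ℤ._+_ (f k)) (×-* n f k)) (sym (ℤ.suc-* (+ n) (f k)))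

theorem6p1 : ∀ (n : ℕ) → 3 ≤ n →
    (+ (n + 1)) · BoNaPoly n
    ≈ (+ (2 * n ∸ 1)) · ((𝟙 ⊕ u) ⊗ BoNaPoly (n ∸ 1))
    ⊖ (+ (n ∸ 2)) · ((u ^ 2 ⊖ (+ 6) · u ⊕ 𝟙) ⊗ BoNaPoly (n ∸ 2))
-- From here on `n` is two less than the index in the statement, so `∸ 1` and `∸ 2` on that index
-- compute to `1 + n` and `n`.
theorem6p1 (suc (suc n)) (s≤s (s≤s _)) k = begin
  coeff ((+ (2 + n + 1)) · BoNaPoly (2 + n)) k
    ≡⟨ coeff-· (+ (2 + n + 1)) (BoNaPoly (2 + n)) k ⟩
  + (2 + n + 1) ℤ.* coeff (BoNaPoly (2 + n)) k
    ≡⟨ cong (ℤ._*_ (+ (2 + n + 1))) (genFun-diag (2 + n) k) ⟨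
  + (2 + n + 1) ℤ.* x
    ≡⟨ rearrange ⟩
  + (2 * (2 + n) ∸ 1) ℤ.* y ℤ.+ ℤ.- 1ℤ ℤ.* (+ n ℤ.* w)
    ≡⟨ cong₂ ℤ._+_ (coeff-·-⊗ (+ (2 * (2 + n) ∸ 1)) c (1 + n))
         (trans (coeff-· (ℤ.- 1ℤ) (+ n · (d ⊗ BoNaPoly n)) k)
           (cong (ℤ._*_ (ℤ.- 1ℤ)) (coeff-·-⊗ (+ n) d n))) ⟨
  coeff (+ (2 * (2 + n) ∸ 1) · (c ⊗ BoNaPoly (1 + n))) k
    ℤ.+ coeff ((ℤ.- 1ℤ) · (+ n · (d ⊗ BoNaPoly n))) k
    ≡⟨ coeff-⊕ (+ (2 * (2 + n) ∸ 1) · (c ⊗ BoNaPoly (1 + n))) _ k ⟨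
  coeff (+ (2 * (2 + n) ∸ 1) · (c ⊗ BoNaPoly (1 + n)) ⊖ + n · (d ⊗ BoNaPoly n)) k ∎
  where
  open ≡-Reasoning
  c = 𝟙 ⊕ u
  d = u ^ 2 ⊖ (+ 6) · u ⊕ 𝟙
  G = λ m → genFun m m
  x = G (2 + n) k
  y = (coeff c U.* G (1 + n)) k
  w = (coeff d U.* G n) k

  coeff-·-⊗ : ∀ a p m → coeff (a · (p ⊗ BoNaPoly m)) k ≡ a ℤ.* (coeff p U.* G m) k
  coeff-·-⊗ a p m = trans (coeff-· a (p ⊗ BoNaPoly m) k) (cong (ℤ._*_ a)
    (trans (coeff-⊗ p (BoNaPoly m) k) (U.*-congˡ {coeff p} (U.sym (genFun-diag m)) k)))

  recurrence : (x ℤ.+ + (2 + n) ℤ.* x) ℤ.+ + n ℤ.* w ≡ y ℤ.+ (+ (1 + n) ℤ.* y ℤ.+ + (1 + n) ℤ.* y)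
  recurrence = begin
    (x ℤ.+ + (2 + n) ℤ.* x) ℤ.+ + n ℤ.* w
      ≡⟨ cong₂ (λ s t → (x ℤ.+ s) ℤ.+ t) (×-* (2 + n) (G (2 + n)) k)
           (trans (U.×-comm-* n (coeff d) (G n) k) (×-* n (coeff d U.* G n) k)) ⟨
    ((G (2 + n) U.+ (2 + n) U.× G (2 + n)) U.+ coeff d U.* (n U.× G n)) k
      ≡⟨ Z.quadratic⇒recurrence
           (U.+-cancelʳ (∙-cancelʳ (AbelianGroup.group ℤ.+-0-abelianGroup)))
           -- `Z.refl` suffices for the initial iterate because `treesUpToHeight 0` is empty.
           (coeff u) (coeff c) (coeff d) G (diagonal-fixpoint Z.refl genFun-suc) discriminant n k ⟩
    (coeff c U.* (G (1 + n) U.+ U.double ((1 + n) U.× G (1 + n)))) k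
      ≡⟨ trans (U.distribˡ (coeff c) (G (1 + n)) _ k)
           (cong (ℤ._+_ y) (trans (U.distribˡ (coeff c) ((1 + n) U.× G (1 + n)) _ k)
             (cong₂ ℤ._+_ cθG cθG))) ⟩
    y ℤ.+ (+ (1 + n) ℤ.* y ℤ.+ + (1 + n) ℤ.* y) ∎
    where
    cθG : (coeff c U.* ((1 + n) U.× G (1 + n))) k ≡ + (1 + n) ℤ.* y
    cθG = trans (U.×-comm-* (1 + n) (coeff c) (G (1 + n)) k) (×-* (1 + n) (coeff c U.* G (1 + n)) k)

  rearrange : + (2 + n + 1) ℤ.* x ≡ + (2 * (2 + n) ∸ 1) ℤ.* y ℤ.+ ℤ.- 1ℤ ℤ.* (+ n ℤ.* w)
  rearrange = begin
    + (2 + n + 1) ℤ.* x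
      ≡⟨ cong (ℤ._* x) (ℤ.pos-+ (2 + n) 1) ⟩
    (+ (2 + n) ℤ.+ 1ℤ) ℤ.* x
      ≡⟨ solve 3 (λ m x v → (m :+ con 1ℤ) :* x := ((x :+ m :* x) :+ v) :+ con (ℤ.- 1ℤ) :* v)
           refl (+ (2 + n)) x (+ n ℤ.* w) ⟩
    ((x ℤ.+ + (2 + n) ℤ.* x) ℤ.+ + n ℤ.* w) ℤ.+ ℤ.- 1ℤ ℤ.* (+ n ℤ.* w)
      ≡⟨ cong (ℤ._+ (ℤ.- 1ℤ ℤ.* (+ n ℤ.* w))) recurrence ⟩
    (y ℤ.+ (+ (1 + n) ℤ.* y ℤ.+ + (1 + n) ℤ.* y)) ℤ.+ ℤ.- 1ℤ ℤ.* (+ n ℤ.* w)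
      ≡⟨ cong (ℤ._+ (ℤ.- 1ℤ ℤ.* (+ n ℤ.* w)))
           (solve 2 (λ m y → y :+ (m :* y :+ m :* y) := (con 1ℤ :+ (m :+ m)) :* y) refl (+ (1 + n)) y) ⟩
    (1ℤ ℤ.+ (+ (1 + n) ℤ.+ + (1 + n))) ℤ.* y ℤ.+ ℤ.- 1ℤ ℤ.* (+ n ℤ.* w)
      ≡⟨ cong (λ m → + m ℤ.* y ℤ.+ ℤ.- 1ℤ ℤ.* (+ n ℤ.* w)) 2n-1 ⟩
    + (2 * (2 + n) ∸ 1) ℤ.* y ℤ.+ ℤ.- 1ℤ ℤ.* (+ n ℤ.* w) ∎
    where
    open ℤ.+-*-Solver
    2n-1 : 1 + ((1 + n) + (1 + n)) ≡ 2 * (2 + n) ∸ 1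
    2n-1 = cong suc (trans (sym (ℕ.+-suc n (1 + n)))
      (cong (λ m → n + (2 + m)) (sym (ℕ.+-identityʳ n))))
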